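{- Let $L$ be one of the logics $\mathbf{S4D}$, $\mathbf{S4DS}$, $\mathbf{S4DT_1S}$. Then $L$ has the finite model property; that is, every bimodal formula $A\notin L$ is refuted in some finite Kripke frame $F=(W,R,R_D)$ validating all formulas of $L$.
   Context: Formulas are built by $\phi ::= p \mid \bot \mid \phi\to\phi \mid \Box\phi \mid [\neq]\phi$, with $p$ ranging over propositional letters; the other Boolean connectives are the usual abbreviations, $\Diamond A=\neg\Box\neg A$, $\langle\neq\rangle A=\neg[\neq]\neg A$, and $[\forall]A=[\neq]A\wedge A$. A (bimodal) logic is a set of formulas containing all classical tautologies, $\Box(p\to q)\to(\Box p\to\Box q)$ and $[\neq](p\to q)\to([\neq]p\to[\neq]q)$, and closed under Substitution, Modus Ponens, and the two Generalization rules $A/\Box A$ and $A/[\neq]A$. $\mathbf{K_2}$ is the minimal logic, and $L+\Gamma$ is the minimal logic containing the logic $L$ and the set of formulas $\Gamma$. $\mathbf{S4D}=\mathbf{K_2}+\{B_D,4_D^-,D_\Box,T_\Box,4_\Box\}$, $\mathbf{S4DS}=\mathbf{S4D}+DS$, $\mathbf{S4DT_1S}=\mathbf{S4DS}+AT_1$, where $B_D$ is $p\to[\neq]\langle\neq\rangle p$; $4_D^-$ is $(p\wedge[\neq]p)\to[\neq][\neq]p$; $D_\Box$ is $[\forall]p\to\Box p$; $T_\Box$ is $\Box p\to p$; $4_\Box$ is $\Box p\to\Box\Box p$; $DS$ is $[\neq]p\to\Diamond p$; $AT_1$ is $[\neq]p\to[\neq]\Box p$. A Kripke frame is $F=(W,R,R_D)$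 with $W$ a non-empty set and $R,R_D$ binary relations on $W$; a valuation $\theta$ assigns to each propositional letter a subset of $W$. Truth of formulas at points of the model $(F,\theta)$ is the usual Kripke truth, with $\Box$ interpreted by $R$ and $[\neq]$ interpreted by $R_D$. A formula is valid in $F$ if it is true at all points under all valuations, and refuted in $F$ otherwise. -}

module Defs where

open import Data.Bool using (Bool; true; false; not; _∨_; T)
open import Data.Empty using (⊥)
open import Data.Fin using (Fin)
open import Data.List using (List; _∷_; [])
open import Data.List.Membership.Propositional using () renaming (_∈_ to _∈ˡ_)
open import Data.Nat using (ℕ)
open import Data.Product using (_×_; ∃-syntax)
open import Function.Bundles using (_↔_)
open import Level using (0ℓ)
open import Relation.Binary.Core using (Rel)
open import Relation.Binary.Definitions using (Decidable)
open import Relation.Binary.PropositionalEquality using (_≡_)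
open import Relation.Nullary using (¬_)
open import Relation.Unary using (Pred; _∈_; _∉_; _⊆_; _∪_; ∅)

infixr 5 _⇒_
infixr 6 _∧_
infix  7 ~_ □_ ◇_ [≠]_ ⟨≠⟩_ [∀]_

data Formula : Set where
  var  : ℕ → Formula
  bot  : Formula
  _⇒_  : Formula → Formula → Formula
  □_   : Formula → Formula
  [≠]_ : Formula → Formula

~_ ◇_ ⟨≠⟩_ [∀]_ : Formula → Formula
_∧_ : Formula → Formula → Formula

~ A    = A ⇒ bot
A ∧ B  = ~ (A ⇒ ~ B)
◇ A    = ~ (□ (~ A))
⟨≠⟩ A  = ~ ([≠] (~ A))
[∀] A  = ([≠] A) ∧ A

substitute : (ℕ → Formula) → Formula → Formula
substitute σ (var n) = σ n
substitute σ bot     = bot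
substitute σ (A ⇒ B) = substitute σ A ⇒ substitute σ B
substitute σ (□ A)   = □ (substitute σ A)
substitute σ ([≠] A) = [≠] (substitute σ A)

-- Boolean evaluation in which letters and formulas with an outermost modality
-- are all treated as atoms.
evalBool : (Formula → Bool) → Formula → Bool
evalBool v (var n) = v (var n)
evalBool v bot     = false
evalBool v (A ⇒ B) = not (evalBool v A) ∨ evalBool v B
evalBool v (□ A)   = v (□ A)
evalBool v ([≠] A) = v ([≠] A)

Tautology : Formula → Set
Tautology A = ∀ (v : Formula → Bool) → evalBool v A ≡ true

p q : Formula
p = var 0
q = var 1

K-□ K-≠ : Formula
K-□ = □ (p ⇒ q) ⇒ (□ p ⇒ □ q)
K-≠ = [≠] (p ⇒ q) ⇒ ([≠] p ⇒ [≠] q)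

record IsLogic (L : Pred Formula 0ℓ) : Set where
  field
    taut  : ∀ {A} → Tautology A → A ∈ L
    k-□   : K-□ ∈ L
    k-≠   : K-≠ ∈ L
    sub   : ∀ {A} (σ : ℕ → Formula) → A ∈ L → substitute σ A ∈ L
    mp    : ∀ {A B} → (A ⇒ B) ∈ L → A ∈ L → B ∈ L
    gen-□ : ∀ {A} → A ∈ L → □ A ∈ L
    gen-≠ : ∀ {A} → A ∈ L → [≠] A ∈ L

data Generated (Γ : Pred Formula 0ℓ) : Pred Formula 0ℓ where
  axiom : ∀ {A} → A ∈ Γ → Generated Γ A
  taut  : ∀ {A} → Tautology A → Generated Γ A
  k-□   : Generated Γ K-□
  k-≠   : Generated Γ K-≠
  sub   : ∀ {A} (σ : ℕ → Formula) → Generated Γ A → Generated Γ (substitute σ A)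
  mp    : ∀ {A B} → Generated Γ (A ⇒ B) → Generated Γ A → Generated Γ B
  gen-□ : ∀ {A} → Generated Γ A → Generated Γ (□ A)
  gen-≠ : ∀ {A} → Generated Γ A → Generated Γ ([≠] A)

-- The next two facts say that Generated Γ is the minimal logic containing Γ.
Generated-isLogic : ∀ Γ → IsLogic (Generated Γ)
Generated-isLogic Γ = record
  { taut = taut ; k-□ = k-□ ; k-≠ = k-≠ ; sub = sub
  ; mp = mp ; gen-□ = gen-□ ; gen-≠ = gen-≠ }

Generated-minimal : ∀ {Γ L} → IsLogic L → Γ ⊆ L → Generated Γ ⊆ L
Generated-minimal {Γ} {L} isLogic Γ⊆L = go
  where
  module I = IsLogic isLogic
  go : Generated Γ ⊆ L
  go (axiom a)   = Γ⊆L a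
  go (taut t)    = I.taut t
  go k-□         = I.k-□
  go k-≠         = I.k-≠
  go (sub σ d)   = I.sub σ (go d)
  go (mp d e)    = I.mp (go d) (go e)
  go (gen-□ d)   = I.gen-□ (go d)
  go (gen-≠ d)   = I.gen-≠ (go d)

K₂ : Pred Formula 0ℓ
K₂ = Generated ∅

infixl 6 _⊕_
_⊕_ : Pred Formula 0ℓ → Pred Formula 0ℓ → Pred Formula 0ℓ
L ⊕ Γ = Generated (L ∪ Γ)

⟦_⟧ : List Formula → Pred Formula 0ℓ
⟦ Γ ⟧ A = A ∈ˡ Γ

B-D 4-D⁻ D-□ T-□ 4-□ DS AT₁ : Formula
B-D  = p ⇒ [≠] (⟨≠⟩ p)
4-D⁻ = (p ∧ [≠] p) ⇒ [≠] ([≠] p)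
D-□  = [∀] p ⇒ □ p
T-□  = □ p ⇒ p
4-□  = □ p ⇒ □ (□ p)
DS   = [≠] p ⇒ ◇ p
AT₁  = [≠] p ⇒ [≠] (□ p)

S4D S4DS S4DT₁S : Pred Formula 0ℓ
S4D    = K₂ ⊕ ⟦ B-D ∷ 4-D⁻ ∷ D-□ ∷ T-□ ∷ 4-□ ∷ [] ⟧
S4DS   = S4D ⊕ ⟦ DS ∷ [] ⟧
S4DT₁S = S4DS ⊕ ⟦ AT₁ ∷ [] ⟧

record Frame : Set₁ where
  field
    W     : Set
    point : W          -- W is non-empty
    R     : Rel W 0ℓ
    R-D   : Rel W 0ℓ

-- Subsets of W are Bool-valued characteristic functions: with Set-valued
-- predicates, excluded middle for letters would not be constructively valid.
Valuation : Frame → Set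
Valuation F = ℕ → Frame.W F → Bool

truth : (F : Frame) → Valuation F → Frame.W F → Formula → Set
truth F θ x (var n) = T (θ n x)
truth F θ x bot     = ⊥
truth F θ x (A ⇒ B) = truth F θ x A → truth F θ x B
truth F θ x (□ A)   = ∀ y → Frame.R F x y → truth F θ y A
truth F θ x ([≠] A) = ∀ y → Frame.R-D F x y → truth F θ y A

Valid : Frame → Formula → Set
Valid F A = ∀ (θ : Valuation F) (x : Frame.W F) → truth F θ x A

Refuted : Frame → Formula → Set
Refuted F A = ¬ Valid F A

-- Decidability of the relations is automatic classically; constructively it is
-- what makes R and R-D finite subsets of W × W.
record Finite (F : Frame) : Set where
  open Frame F
  field
    size  : ℕ
    enum  : W ↔ Fin size
    R?    : Decidable R
    R-D?  : Decidable R-D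

HasFMP : Pred Formula 0ℓ → Set₁
HasFMP L = ∀ (A : Formula) → A ∉ L →
  ∃[ F ] (Finite F × (∀ B → B ∈ L → Valid F B) × Refuted F A)

{-# OPTIONS --safe #-}
module Submission where

-- Let χ₁, …, χₙ be the atoms generated by the subformulas of A. Choose a formula C
-- with C ⇒ A ∉ L that decides every [∀] ~ χᵢ, and let Th consist of all X
-- with C ⇒ [∀] X ∈ L. The points are the atoms; R is the reflexive transitive closure
-- of "(χᵢ ⇒ □ ~ χⱼ) ∉ Th", and R-D relates any two distinct live atoms (those with
-- ~ χᵢ ∉ Th), and χᵢ to itself unless (χᵢ ⇒ [≠] ~ χᵢ) ∈ Th. Thus an irreflexive point
-- is an atom true at only one world, which is why DS and AT₁ pass to the filtration.
-- Dead atoms are isolated reflexive points.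
--
-- Membership in Th is undecidable a priori, so all this takes place under a double
-- negation. The frame itself comes from a search through all pairs of relations on the
-- n atoms: each candidate can be checked, and the argument above refutes the failure
-- of the search.

open import Defs
open import Data.Bool using (Bool; true; false; not; _∨_; T)
open import Data.Bool.Properties using (T?; T-≡)
open import Data.Empty using (⊥; ⊥-elim)
open import Data.Fin using (Fin; zero; splitAt; join; combine; remQuot)
open import Data.Fin.Properties using (_≟_; all?; any?; sequence; remQuot-combine; splitAt-join; join-splitAt)
open import Data.Fin.Subset using (Subset) renaming (_∈_ to _∈ˢ_)
open import Data.Fin.Subset.Properties using (_∈?_; anySubset?)
open import Data.List using (List; []; _∷_; _++_)
import Data.List as List
open import Data.List.Membership.Propositional using () renaming (_∈_ to _∈ˡ_)
open import Data.List.Membership.Propositional.Properties using (∈-++⁺ˡ; ∈-++⁺ʳ)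
open import Data.List.Relation.Unary.All using (All; []; _∷_)
import Data.List.Relation.Unary.All.Properties as AllP
open import Data.List.Relation.Unary.Any using (here; there)
import Data.List.Relation.Unary.Any as Any
open import Data.Nat using (ℕ; _+_) renaming (_*_ to _*ℕ_)
import Data.Nat as ℕ
open import Data.Product using (_×_; _,_; proj₁; proj₂; ∃-syntax)
open import Data.Sum using (_⊎_; inj₁; inj₂)
import Data.Sum as Sum
open import Data.Unit using (⊤; tt)
open import Data.Vec using (tabulate; lookup)
open import Data.Vec.Properties using (lookup∘tabulate; lookup⇒[]=; []=⇒lookup)
open import Effect.Monad using (RawMonad)
open import Function using (_∘_; id)
open import Function.Bundles using (Inverse; Equivalence; _⇔_; mk⇔)
open import Function.Construct.Identity using (↔-id)
open import Level using (0ℓ)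
open import Relation.Binary.Construct.Closure.ReflexiveTransitive using (Star; ε; _◅_; _◅◅_)
open import Relation.Binary.Core using (Rel)
open import Relation.Binary.PropositionalEquality
  using (_≡_; _≢_; refl; sym; trans; cong; subst)
open import Relation.Nullary using (¬_; Dec; yes; no; does)
open import Relation.Nullary.Decidable
  using (decidable-stable; dec-true; map′; ¬?; _×-dec_; _⊎-dec_; _→-dec_; ¬¬-excluded-middle)
open import Relation.Nullary.Negation using (¬¬-Monad; contradiction)
open import Relation.Unary using (Pred; _∈_; _⊆_)

-- Propositional reasoning through Boolean evaluation.

private variable
  A B X Y : Formula
  v : Formula → Bool

-- A record rather than an alias for T (evalBool v A), so that v and A are inferable.
infix 4 _⊨_
record _⊨_ (v : Formula → Bool) (A : Formula) : Set where
  constructor ⟨_⟩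
  field holds : T (evalBool v A)
open _⊨_

⊨? : ∀ v A → Dec (v ⊨ A)
⊨? v A = map′ ⟨_⟩ holds (T? (evalBool v A))

⊨-stable : ¬ ¬ (v ⊨ A) → v ⊨ A
⊨-stable {v} {A} = decidable-stable (⊨? v A)

⊭bot : ¬ (v ⊨ bot)
⊭bot ()

⇒I : (v ⊨ A → v ⊨ B) → v ⊨ A ⇒ B
⇒I {v} {A} {B} f = ⟨ go (evalBool v A) (holds ∘ f ∘ ⟨_⟩) ⟩
  where
  go : ∀ a → (T a → T (evalBool v B)) → T (not a ∨ evalBool v B)
  go true  g = g tt
  go false g = tt

⇒E : v ⊨ A ⇒ B → v ⊨ A → v ⊨ B
⇒E {v} {A} {B} ⟨ f ⟩ ⟨ a ⟩ = ⟨ go (evalBool v A) f a ⟩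
  where
  go : ∀ a → T (not a ∨ evalBool v B) → T a → T (evalBool v B)
  go true g _ = g

~I : ¬ (v ⊨ A) → v ⊨ ~ A
~I f = ⇒I (⊥-elim ∘ f)

~E : v ⊨ ~ A → ¬ (v ⊨ A)
~E f a = ⊭bot (⇒E f a)

∧I : v ⊨ A → v ⊨ B → v ⊨ A ∧ B
∧I a b = ~I λ f → ~E (⇒E f a) b

∧E₁ : v ⊨ A ∧ B → v ⊨ A
∧E₁ h = ⊨-stable λ ¬a → ~E h (⇒I (⊥-elim ∘ ¬a))

∧E₂ : v ⊨ A ∧ B → v ⊨ B
∧E₂ h = ⊨-stable λ ¬b → ~E h (⇒I λ _ → ~I ¬b)

-- Deductively closed sets and normal modalities.

record Deductive (Q : Pred Formula 0ℓ) : Set where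
  field
    ⊨⇒∈    : (∀ {v} → v ⊨ A) → Q A
    detach : Q (A ⇒ B) → Q A → Q B

-- The premises are moved one by one into an implication, which is a tautology in the end, and then
-- detached. Derivations below thus reduce to Boolean arguments about an arbitrary `v`.
entail : ∀ {Q Γ} → Deductive Q → All Q Γ → (∀ {v} → All (v ⊨_) Γ → v ⊨ X) → Q X
entail D []       sem = Deductive.⊨⇒∈ D (sem [])
entail D (a ∷ as) sem = Deductive.detach D (entail D as λ hs → ⇒I λ h → sem (h ∷ hs)) a

record Modality (Q : Pred Formula 0ℓ) (M : Formula → Formula) : Set where
  field
    k   : Q (M (A ⇒ B) ⇒ (M A ⇒ M B))
    nec : Q A → Q (M A)

module _ {Q : Pred Formula 0ℓ} (D : Deductive Q) where

  weaken : ∀ H → Q X → Q (H ⇒ X)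
  weaken H x = entail D (x ∷ []) λ { (x ∷ []) → ⇒I λ _ → x }

  assuming : ∀ H → Deductive (λ X → Q (H ⇒ X))
  assuming H = record
    { ⊨⇒∈ = λ t → weaken H (Deductive.⊨⇒∈ D t)
    ; detach = λ f a → entail D (f ∷ a ∷ []) λ { (f ∷ a ∷ []) → ⇒I λ h → ⇒E (⇒E f h) (⇒E a h) }
    }

  module _ {M : Formula → Formula} (mod : Modality Q M) where
    open Modality mod

    -- By `k` and `nec`, what lies under a modality is again deductively closed, so `entail` also
    -- works inside a box.
    under : ∀ H → Deductive (λ X → Q (H ⇒ M X))
    under H = record
      { ⊨⇒∈ = λ t → weaken H (nec (Deductive.⊨⇒∈ D t))
      ; detach = λ f a → entail D (k ∷ f ∷ a ∷ [])
                 λ { (k ∷ f ∷ a ∷ []) → ⇒I λ h → ⇒E (⇒E k (⇒E f h)) (⇒E a h) }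
      }

    mono : Q (X ⇒ Y) → Q (M X ⇒ M Y)
    mono f = Deductive.detach D k (nec f)

-- Theories with the axioms of S4D.

-- The axioms are schematic in `A`, since the theories of interest contain local assumptions and
-- need not be closed under Substitution.
record S4DTheory (Q : Pred Formula 0ℓ) : Set where
  field
    ded   : Deductive Q
    mod-□ : Modality Q □_
    mod-≠ : Modality Q [≠]_
    ax-B   : Q (A ⇒ [≠] ⟨≠⟩ A)
    ax-4D  : Q ((A ∧ [≠] A) ⇒ [≠] [≠] A)
    ax-D   : Q ([∀] A ⇒ □ A)
    ax-T   : Q (□ A ⇒ A)
    ax-4   : Q (□ A ⇒ □ □ A)

⊨⇒≡true : v ⊨ A → evalBool v A ≡ true
⊨⇒≡true = Equivalence.to T-≡ ∘ holds

isLogic⇒S4DTheory : ∀ {L} → IsLogic L → S4D ⊆ L → S4DTheory L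
isLogic⇒S4DTheory {L} isLogic S4D⊆L = record
  { ded   = record { ⊨⇒∈ = λ t → I.taut λ v → ⊨⇒≡true {v} t ; detach = I.mp }
  ; mod-□ = record { k = λ {A} {B} → I.sub (pair A B) I.k-□ ; nec = I.gen-□ }
  ; mod-≠ = record { k = λ {A} {B} → I.sub (pair A B) I.k-≠ ; nec = I.gen-≠ }
  ; ax-B   = λ {A} → instantiate B-D A (here refl)
  ; ax-4D  = λ {A} → instantiate 4-D⁻ A (there (here refl))
  ; ax-D   = λ {A} → instantiate D-□ A (there (there (here refl)))
  ; ax-T   = λ {A} → instantiate T-□ A (there (there (there (here refl))))
  ; ax-4   = λ {A} → instantiate 4-□ A (there (there (there (there (here refl)))))
  }
  where
  module I = IsLogic isLogic
  pair : Formula → Formula → ℕ → Formula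
  pair A B ℕ.zero    = A
  pair A B (ℕ.suc _) = B
  instantiate : ∀ Ax A → Ax ∈ ⟦ B-D ∷ 4-D⁻ ∷ D-□ ∷ T-□ ∷ 4-□ ∷ [] ⟧ → L (substitute (λ _ → A) Ax)
  instantiate Ax A m = I.sub (λ _ → A) (S4D⊆L (axiom (inj₂ m)))

-- Global theories and finite Lindenbaum extensions.

module _ {L : Pred Formula 0ℓ} (S : S4DTheory L) where
  open S4DTheory S

  -- With 4-D⁻ and B-D the modality [∀] is S5; this is the essential half of axiom 5.
  ~[∀]⇒[≠]~[∀] : ∀ A → L (~ ([∀] (~ A)) ⇒ [≠] ~ ([∀] (~ A)))
  ~[∀]⇒[≠]~[∀] A = entail ded (here-case ∷ there-case ∷ [])
    -- The formula `~ U` says that `A` holds here or at an `R-D`-successor. B-D settles the first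
    -- case, B-D together with 4-D⁻ the second.
    λ { (f ∷ g ∷ []) → ⇒I λ ¬u → ⊨-stable λ ¬n →
        ~E ¬u (∧I (⊨-stable λ ¬h → ¬n (⇒E g (~I ¬h)))
                  (~I λ a → ¬n (⇒E f a))) }
    where
    U = [∀] (~ A)
    here-case : L (A ⇒ [≠] ~ U)
    here-case = entail (under ded mod-≠ A) (ax-B ∷ [])
      λ { (b ∷ []) → ~I λ u → ~E b (∧E₁ u) }
    there-case : L (~ ([≠] (~ A)) ⇒ [≠] ~ U)
    there-case = entail (under ded mod-≠ _)
      (ax-B ∷ weaken ded _ (nec ¬¬-intro) ∷ weaken ded _ (nec ax-4D) ∷ [])
      λ { (b ∷ m ∷ f ∷ []) → ~I λ u → ~E b (⇒E m (⇒E f (∧I (∧E₂ u) (∧E₁ u)))) }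
      where
      open Modality mod-≠
      ¬¬-intro : L ([≠] [≠] (~ A) ⇒ [≠] ~ ~ ([≠] (~ A)))
      ¬¬-intro = mono ded mod-≠ (Deductive.⊨⇒∈ ded (⇒I λ x → ~I λ y → ~E y x))

  -- These are the two conjuncts of `C ⇒ [∀] X`. The first alone need not be closed under
  -- generalization; with both, 4-D⁻ yields closure under `[≠]` and D-□ closure under `□`.
  Global : Formula → Pred Formula 0ℓ
  Global C X = L (C ⇒ X) × L (C ⇒ [≠] X)

  module _ (C : Formula) where
    private
      D : Deductive (λ X → L (C ⇒ X))
      D = assuming ded C
      D≠ : Deductive (λ X → L (C ⇒ [≠] X))
      D≠ = under ded mod-≠ C

      lift : L X → Global C X
      lift x = weaken ded C x , weaken ded C (Modality.nec mod-≠ x)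

      nec-≠ : Global C X → Global C ([≠] X)
      nec-≠ (x , x≠) = x≠ ,
        entail D (proj₁ (lift ax-4D) ∷ x ∷ x≠ ∷ [])
          λ { (f ∷ x ∷ x≠ ∷ []) → ⇒E f (∧I x x≠) }

      nec-□ : Global C X → Global C (□ X)
      nec-□ h@(x , x≠) =
        entail D (proj₁ (lift ax-D) ∷ x ∷ x≠ ∷ [])
          (λ { (f ∷ x ∷ x≠ ∷ []) → ⇒E f (∧I x≠ x) }) ,
        entail D≠ (proj₂ (lift ax-D) ∷ x≠ ∷ proj₂ (nec-≠ h) ∷ [])
          λ { (f ∷ x ∷ x≠ ∷ []) → ⇒E f (∧I x≠ x) }

    Global-S4D : S4DTheory (Global C)
    Global-S4D = record
      { ded   = record { ⊨⇒∈ = λ t → lift (Deductive.⊨⇒∈ ded t)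
                       ; detach = λ (f , f≠) (a , a≠) → Deductive.detach D f a , Deductive.detach D≠ f≠ a≠ }
      ; mod-□ = record { k = lift (Modality.k mod-□) ; nec = nec-□ }
      ; mod-≠ = record { k = lift (Modality.k mod-≠) ; nec = nec-≠ }
      ; ax-B = lift ax-B ; ax-4D = lift ax-4D ; ax-D = lift ax-D ; ax-T = lift ax-T ; ax-4 = lift ax-4 }

    Global-⊇ : L ⊆ Global C
    Global-⊇ = lift

    Global-⊆ : Global C X → L (C ⇒ X)
    Global-⊆ = proj₁

    Global-[∀] : L (C ⇒ [∀] X) → Global C X
    Global-[∀] h = entail D (h ∷ []) (λ { (h ∷ []) → ∧E₂ h }) , entail D (h ∷ []) λ { (h ∷ []) → ∧E₁ h }

    -- By the S5 law above, a failure of `[∀]` is itself a global fact. Hence either decision about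
    -- `[∀] (~ χ i)` enters the theory.
    Global-~[∀]~ : L (C ⇒ ~ ([∀] (~ X))) → Global C (~ ([∀] (~ X)))
    Global-~[∀]~ {X} h = h , entail D (h ∷ weaken ded C (~[∀]⇒[≠]~[∀] X) ∷ [])
      λ { (h ∷ f ∷ []) → ⇒E f h }

-- A Lindenbaum construction for a finite list: if both `C ∧ U` and `C ∧ ~ U` implied `A`, so would
-- `C`. Each choice depends on membership in `L`, hence the double negation.
decide-all : ∀ {L} → Deductive L → ∀ Γ C → ¬ L (C ⇒ A) →
  ¬ ¬ (∃[ C′ ] L (C′ ⇒ C) × ¬ L (C′ ⇒ A) × All (λ U → L (C′ ⇒ U) ⊎ L (C′ ⇒ ~ U)) Γ)
decide-all D [] C C⊬A no-ext = no-ext (C , Deductive.⊨⇒∈ D (⇒I id) , C⊬A , [])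
decide-all {A} {L} D (U ∷ Γ) C C⊬A no-ext =
  ¬¬-excluded-middle λ where
    (no U⊬)  → decide-all D Γ (C ∧ U) U⊬ λ (C′ , C′C , C′⊬A , ds) → no-ext
      (C′ , entail D (C′C ∷ []) (λ { (f ∷ []) → ⇒I λ c → ∧E₁ (⇒E f c) }) , C′⊬A ,
       inj₁ (entail D (C′C ∷ []) λ { (f ∷ []) → ⇒I λ c → ∧E₂ (⇒E f c) }) ∷ ds)
    (yes U⊢) → decide-all D Γ (C ∧ ~ U)
      (λ ¬U⊢ → C⊬A (entail D (U⊢ ∷ ¬U⊢ ∷ []) (both C)))
      λ (C′ , C′C , C′⊬A , ds) → no-ext
      (C′ , entail D (C′C ∷ []) (λ { (f ∷ []) → ⇒I λ c → ∧E₁ (⇒E f c) }) , C′⊬A ,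
       inj₂ (entail D (C′C ∷ []) λ { (f ∷ []) → ⇒I λ c → ∧E₂ (⇒E f c) }) ∷ ds)
  where
  both : ∀ C {v} → All (v ⊨_) ((C ∧ U ⇒ A) ∷ (C ∧ ~ U ⇒ A) ∷ []) → v ⊨ C ⇒ A
  both C (f ∷ g ∷ []) = ⇒I λ c → ⊨-stable λ ¬a →
    ¬a (⇒E g (∧I c (~I λ u → ¬a (⇒E f (∧I c u)))))

-- Boolean atoms over a finite set of formulas.

-- The atoms of the Boolean algebra generated by Ψ, some of which may be contradictory.
record Partition (Ψ : List Formula) : Set where
  field
    size       : ℕ
    χ          : Fin size → Formula
    exclusive  : ∀ {v} i j → v ⊨ χ i → v ⊨ χ j → i ≡ j
    exhaustive : ∀ v → ∃[ i ] v ⊨ χ i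
    decides    : ∀ i {ψ} → ψ ∈ˡ Ψ → (∀ {v} → v ⊨ χ i → v ⊨ ψ) ⊎ (∀ {v} → v ⊨ χ i → v ⊨ ~ ψ)

partition : ∀ Ψ → Partition Ψ
partition []      = record
  { size = 1 ; χ = λ _ → ~ bot
  ; exclusive  = λ { zero zero _ _ → refl }
  ; exhaustive = λ v → zero , ~I ⊭bot
  ; decides    = λ _ ()
  }
partition (ψ ∷ Ψ) = record
  -- Each old atom splits in two: the left half asserts `ψ`, the right half denies it.
  { size = size + size ; χ = χ′ ∘ splitAt size
  ; exclusive  = λ i j hᵢ hⱼ → trans (sym (join-splitAt size size i))
      (trans (cong (join size size) (exclusive′ (splitAt size i) (splitAt size j) hᵢ hⱼ))
             (join-splitAt size size j))
  ; exhaustive = λ v → let (s , h) = exhaustive′ v in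
      join size size s , subst (λ s → v ⊨ χ′ s) (sym (splitAt-join size size s)) h
  ; decides    = decides′ ∘ splitAt size
  }
  where
  open Partition (partition Ψ)
  χ′ : Fin size ⊎ Fin size → Formula
  χ′ (inj₁ i) = ψ ∧ χ i
  χ′ (inj₂ i) = ~ ψ ∧ χ i

  exclusive′ : ∀ {v} s t → v ⊨ χ′ s → v ⊨ χ′ t → s ≡ t
  exclusive′ (inj₁ i) (inj₁ j) h h′ = cong inj₁ (exclusive i j (∧E₂ h) (∧E₂ h′))
  exclusive′ (inj₁ i) (inj₂ j) h h′ = ⊥-elim (~E (∧E₁ h′) (∧E₁ h))
  exclusive′ (inj₂ i) (inj₁ j) h h′ = ⊥-elim (~E (∧E₁ h) (∧E₁ h′))
  exclusive′ (inj₂ i) (inj₂ j) h h′ = cong inj₂ (exclusive i j (∧E₂ h) (∧E₂ h′))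

  exhaustive′ : ∀ v → ∃[ s ] v ⊨ χ′ s
  exhaustive′ v with exhaustive v | ⊨? v ψ
  ... | i , h | yes y = inj₁ i , ∧I y h
  ... | i , h | no n  = inj₂ i , ∧I (~I n) h

  decides′ : ∀ s {ψ′} → ψ′ ∈ˡ ψ ∷ Ψ →
    (∀ {v} → v ⊨ χ′ s → v ⊨ ψ′) ⊎ (∀ {v} → v ⊨ χ′ s → v ⊨ ~ ψ′)
  decides′ (inj₁ i) (here refl) = inj₁ ∧E₁
  decides′ (inj₂ i) (here refl) = inj₂ ∧E₁
  decides′ (inj₁ i) (there m)   = Sum.map (λ f h → f (∧E₂ h)) (λ f h → f (∧E₂ h)) (decides i m)
  decides′ (inj₂ i) (there m)   = Sum.map (λ f h → f (∧E₂ h)) (λ f h → f (∧E₂ h)) (decides i m)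

-- Decidable truth in finite frames and soundness.

module FiniteFrame {F : Frame} (fin : Finite F) where
  open Frame F
  open Finite fin
  open Inverse enum using (to; from; strictlyInverseʳ)

  all-W? : {P : W → Set} → (∀ x → Dec (P x)) → Dec (∀ x → P x)
  all-W? {P} P? = map′ (λ f x → subst P (strictlyInverseʳ x) (f (to x))) (λ f i → f (from i))
                       (all? (P? ∘ from))

  any-W? : {P : W → Set} → (∀ x → Dec (P x)) → Dec (∃[ x ] P x)
  any-W? {P} P? = map′ (λ (i , p) → from i , p)
                       (λ (x , p) → to x , subst P (sym (strictlyInverseʳ x)) p)
                       (any? (P? ∘ from))

  truth? : ∀ θ x B → Dec (truth F θ x B)
  truth? θ x (var n) = T? (θ n x)
  truth? θ x bot     = no id
  truth? θ x (A ⇒ B) = truth? θ x A →-dec truth? θ x B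
  truth? θ x (□ A)   = all-W? λ y → R? x y →-dec truth? θ y A
  truth? θ x ([≠] A) = all-W? λ y → R-D? x y →-dec truth? θ y A

  -- Tautologies are valid because truth at a point is a Boolean evaluation with modal formulas as
  -- atoms. Finiteness makes truth decidable and so supplies the Booleans.
  ⊨-truth : ∀ θ x A → (λ B → does (truth? θ x B)) ⊨ A ⇔ truth F θ x A
  ⊨-truth θ x = go
    where
    w = λ B → does (truth? θ x B)
    atom : ∀ B → T (w B) ⇔ truth F θ x B
    atom B with truth? θ x B
    ... | yes t = mk⇔ (λ _ → t) (λ _ → tt)
    ... | no ¬t = mk⇔ (λ ()) ¬t
    go : ∀ A → w ⊨ A ⇔ truth F θ x A
    go (var n) = mk⇔ (Equivalence.to (atom (var n)) ∘ holds) (⟨_⟩ ∘ Equivalence.from (atom (var n)))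
    go bot     = mk⇔ ⊭bot ⊥-elim
    go (A ⇒ B) = mk⇔ (λ h → Equivalence.to (go B) ∘ ⇒E h ∘ Equivalence.from (go A))
                     (λ f → ⇒I (Equivalence.from (go B) ∘ f ∘ Equivalence.to (go A)))
    go (□ A)   = mk⇔ (Equivalence.to (atom (□ A)) ∘ holds) (⟨_⟩ ∘ Equivalence.from (atom (□ A)))
    go ([≠] A) = mk⇔ (Equivalence.to (atom ([≠] A)) ∘ holds) (⟨_⟩ ∘ Equivalence.from (atom ([≠] A)))

  module _ (σ : ℕ → Formula) (θ : Valuation F) where
    pullback : Valuation F
    pullback n x = does (truth? θ x (σ n))

    truth-substitute : ∀ x B → truth F pullback x B ⇔ truth F θ x (substitute σ B)
    truth-substitute x (var n) with truth? θ x (σ n)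
    ... | yes t = mk⇔ (λ _ → t) (λ _ → tt)
    ... | no ¬t = mk⇔ (λ ()) ¬t
    truth-substitute x bot     = mk⇔ id id
    truth-substitute x (A ⇒ B) = mk⇔ (λ f → B.to ∘ f ∘ A.from) (λ f → B.from ∘ f ∘ A.to)
      where
      module A = Equivalence (truth-substitute x A)
      module B = Equivalence (truth-substitute x B)
    truth-substitute x (□ A)   = mk⇔
      (λ f y r → Equivalence.to (truth-substitute y A) (f y r))
      (λ f y r → Equivalence.from (truth-substitute y A) (f y r))
    truth-substitute x ([≠] A) = mk⇔
      (λ f y r → Equivalence.to (truth-substitute y A) (f y r))
      (λ f y r → Equivalence.from (truth-substitute y A) (f y r))

  Valid-isLogic : IsLogic (Valid F)
  Valid-isLogic = record
    { taut  = λ {A} t θ x → Equivalence.to (⊨-truth θ x A) ⟨ Equivalence.from T-≡ (t _) ⟩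
    ; k-□   = λ θ x f g y r → f y r (g y r)
    ; k-≠   = λ θ x f g y r → f y r (g y r)
    ; sub   = λ {A} σ h θ x → Equivalence.to (truth-substitute σ θ x A) (h _ x)
    ; mp    = λ f a θ x → f θ x (a θ x)
    ; gen-□ = λ a θ x y _ → a θ y
    ; gen-≠ = λ a θ x y _ → a θ y
    }

module _ (F : Frame) where
  open Frame F

  -- The first five conditions are the first-order counterparts of B-D, 4-D⁻, D-□, T-□ and 4-□, in
  -- this order; `Serial` belongs to DS and `T₁` to AT₁.
  SymmetricD WeaklyTransitiveD WithinD ReflexiveR TransitiveR S4DFrame Serial T₁ : Set
  SymmetricD        = ∀ x y → R-D x y → R-D y x
  WeaklyTransitiveD = ∀ x y z → R-D x y → R-D y z → x ≡ z ⊎ R-D x z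
  WithinD           = ∀ x y → R x y → x ≡ y ⊎ R-D x y
  ReflexiveR        = ∀ x → R x x
  TransitiveR       = ∀ x y z → R x y → R y z → R x z
  S4DFrame          = SymmetricD × WeaklyTransitiveD × WithinD × ReflexiveR × TransitiveR
  Serial            = ∀ x → ∃[ y ] R x y × R-D x y
  T₁                = ∀ x y z → R-D x y → R y z → R-D x z

module Sound {F : Frame} (fin : Finite F) (isS4D : S4DFrame F) where
  open Frame F
  open FiniteFrame fin

  S4D-valid : S4D ⊆ Valid F
  S4D-valid = Generated-minimal Valid-isLogic λ where
      (inj₁ d) → Generated-minimal Valid-isLogic (λ ()) d
      (inj₂ m) → axioms m
    where
    axioms : ⟦ B-D ∷ 4-D⁻ ∷ D-□ ∷ T-□ ∷ 4-□ ∷ [] ⟧ ⊆ Valid F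
    axioms (here refl) θ x px y xy f = f x (proj₁ isS4D x y xy) px
    axioms (there (here refl)) θ x h y xy z yz =
      -- Conjunction is a negated implication, so it can be taken apart only towards a
      -- contradiction; the goal is a Boolean and hence stable.
      decidable-stable (T? (θ 0 z)) λ ¬pz → h λ px p≠ →
        ¬pz (Sum.[ (λ { refl → px }) , p≠ z ] (proj₁ (proj₂ isS4D) x y z xy yz))
    axioms (there (there (here refl))) θ x h y xy =
      decidable-stable (T? (θ 0 y)) λ ¬py → h λ p≠ px →
        ¬py (Sum.[ (λ { refl → px }) , p≠ y ] (proj₁ (proj₂ (proj₂ isS4D)) x y xy))
    axioms (there (there (there (here refl)))) θ x h =
      h x (proj₁ (proj₂ (proj₂ (proj₂ isS4D))) x)
    axioms (there (there (there (there (here refl))))) θ x h y xy z yz =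
      h z (proj₂ (proj₂ (proj₂ (proj₂ isS4D))) x y z xy yz)

  S4DS-valid : Serial F → S4DS ⊆ Valid F
  S4DS-valid serial = Generated-minimal Valid-isLogic λ where
    (inj₁ d)           → S4D-valid d
    (inj₂ (here refl)) θ x p≠ f → let (y , xy , xy≠) = serial x in f y xy (p≠ y xy≠)

  S4DT₁S-valid : Serial F → T₁ F → S4DT₁S ⊆ Valid F
  S4DT₁S-valid serial t₁ = Generated-minimal Valid-isLogic λ where
    (inj₁ d)           → S4DS-valid serial d
    (inj₂ (here refl)) θ x p≠ y xy z yz → p≠ z (t₁ x y z xy yz)

-- Subformulas and the valuation on atoms.

subformulas : Formula → List Formula
subformulas (var n) = var n ∷ []
subformulas bot     = bot ∷ []
subformulas (A ⇒ B) = (A ⇒ B) ∷ subformulas A ++ subformulas B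
subformulas (□ A)   = □ A ∷ subformulas A
subformulas ([≠] A) = [≠] A ∷ subformulas A

self∈subformulas : ∀ A → A ∈ˡ subformulas A
self∈subformulas (var n) = here refl
self∈subformulas bot     = here refl
self∈subformulas (A ⇒ B) = here refl
self∈subformulas (□ A)   = here refl
self∈subformulas ([≠] A) = here refl

var? : ∀ n ψ → Dec (var n ≡ ψ)
var? n (var m) = map′ (cong var) (λ { refl → refl }) (n ℕ.≟ m)
var? n bot     = no λ ()
var? n (A ⇒ B) = no λ ()
var? n (□ A)   = no λ ()
var? n ([≠] A) = no λ ()

module Atoms {Ψ : List Formula} (P : Partition Ψ) where
  open Partition P

  Pos Neg : Fin size → Formula → Set
  Pos i ψ = ∀ {v} → v ⊨ χ i → v ⊨ ψ
  Neg i ψ = Pos i (~ ψ)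

  -- Read off from `decides` without reference to the logic, so the valuation is fixed before the
  -- search for a frame. Letters outside `Ψ` default to false.
  letters : ℕ → Fin size → Bool
  letters n i with Any.any? (var? n) Ψ
  ... | yes m = Sum.[ (λ _ → true) , (λ _ → false) ] (decides i m)
  ... | no _  = false

  letter⇒Pos : ∀ {n} → var n ∈ˡ Ψ → ∀ i → T (letters n i) → Pos i (var n)
  letter⇒Pos {n} m i t with Any.any? (var? n) Ψ
  ... | no ¬m = contradiction m ¬m
  ... | yes m′ with decides i m′
  ...   | inj₁ pos = pos

  ¬letter⇒Neg : ∀ {n} → var n ∈ˡ Ψ → ∀ i → ¬ T (letters n i) → Neg i (var n)
  ¬letter⇒Neg {n} m i ¬t with Any.any? (var? n) Ψ
  ... | no ¬m = contradiction m ¬m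
  ... | yes m′ with decides i m′
  ...   | inj₁ pos = contradiction tt ¬t
  ...   | inj₂ neg = neg

  -- The disjunction of all atoms is a tautology. Applied to `under`, this is a case distinction
  -- inside a modality.
  by-cases : ∀ {Q} → Deductive Q → (∀ i → Q (χ i ⇒ X)) → Q X
  by-cases D f = entail D (AllP.tabulate⁺ f) λ {v} hs →
    let (i , h) = exhaustive v in ⇒E (AllP.tabulate⁻ hs i) h

  distinct : ∀ {i j} → i ≢ j → Neg i (χ j)
  distinct i≢j hᵢ = ~I λ hⱼ → i≢j (exclusive _ _ hᵢ hⱼ)

-- The filtration through atoms.

module Canonical
  {Th : Pred Formula 0ℓ} (S : S4DTheory Th) (consistent : ¬ Th bot)
  {Ψ : List Formula} (P : Partition Ψ)
  (live : ∀ i → Th (~ Partition.χ P i) ⊎ Th (~ ([∀] (~ Partition.χ P i))))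
  (seen-□? : ∀ i j → Dec (Th (Partition.χ P i ⇒ □ ~ Partition.χ P j)))
  (seen-≠? : ∀ i → Dec (Th (Partition.χ P i ⇒ [≠] ~ Partition.χ P i)))
  where

  open Partition P

  open S4DTheory S
  open Atoms P
  open Deductive ded
  private
    module □ = Modality mod-□
    module ≠ = Modality mod-≠

  Live Irreflexive : Fin size → Set
  Live i        = ¬ Th (~ χ i)
  Irreflexive i = Th (χ i ⇒ [≠] ~ χ i)

  -- `R₀` is the minimal filtration for `□`. The proviso `Live i →` makes dead atoms reflexive, so
  -- that `Serial` holds at them too.
  R₀ Sees R≠ : Rel (Fin size) 0ℓ
  R₀ i j = ¬ Th (χ i ⇒ □ ~ χ j)
  Sees   = Star R₀
  R≠ i j = (i ≡ j × (Live i → ¬ Irreflexive i)) ⊎ (i ≢ j × Live i × Live j)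

  [∀]-intro : Th X → Th ([∀] X)
  [∀]-intro x = entail ded (x ∷ ≠.nec x ∷ []) λ { (x ∷ x≠ ∷ []) → ∧I x≠ x }

  dead-or-Live : ∀ i → Th (~ χ i) ⊎ Live i
  dead-or-Live i = Sum.map₂ (λ some dead → consistent (detach some ([∀]-intro dead))) (live i)

  somewhere : ∀ {i} → Live i → Th (~ ([∀] (~ χ i)))
  somewhere {i} l with live i
  ... | inj₁ dead = contradiction dead l
  ... | inj₂ some = some

  pos : ∀ {i} → Pos i X → Th (χ i ⇒ X)
  pos f = ⊨⇒∈ (⇒I f)

  pos-neg : ∀ {i} → Live i → Pos i X → ¬ Neg i X
  pos-neg l f g = l (⊨⇒∈ (~I λ h → ~E (g h) (f h)))

  clash : ∀ {i} → Live i → Neg i X → ¬ Th (χ i ⇒ X)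
  clash l g f = l (entail ded (f ∷ []) λ { (f ∷ []) → ~I λ h → ~E (g h) (⇒E f h) })

  R₀-source : ∀ {i j} → R₀ i j → Live i
  R₀-source r dead = r (entail ded (dead ∷ []) λ { (d ∷ []) → ⇒I λ h → ⊥-elim (~E d h) })

  R₀-target : ∀ {i j} → R₀ i j → Live j
  R₀-target {i} r dead = r (weaken ded (χ i) (□.nec dead))

  Sees-source : ∀ {i j} → i ≢ j → Sees i j → Live i
  Sees-source i≢j ε       = contradiction refl i≢j
  Sees-source i≢j (r ◅ _) = R₀-source r

  Sees-target : ∀ {i j} → Live i → Sees i j → Live j
  Sees-target l ε        = l
  Sees-target l (r ◅ rs) = Sees-target (R₀-target r) rs

  -- If `χ j` denied `□ X`, then 4-□ would give `χ i ⇒ □ ~ χ j`, against `R₀ i j`. So boxes survive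
  -- along paths, and passing to `Star R₀` is harmless.
  R₀-□ : ∀ {i j} → □ X ∈ˡ Ψ → R₀ i j → Pos i (□ X) → Pos j (□ X)
  R₀-□ {X} {i} {j} m r f with decides j m
  ... | inj₁ g = g
  ... | inj₂ g = contradiction
    (entail (under ded mod-□ (χ i))
      (entail ded (ax-4 ∷ []) (λ { (t ∷ []) → ⇒I λ h → ⇒E t (f h) }) ∷ [])
      λ { (x ∷ []) → ~I λ h → ~E (g h) x })
    r

  Sees-□ : ∀ {i j} → □ X ∈ˡ Ψ → Sees i j → Pos i (□ X) → Pos j (□ X)
  Sees-□ m ε        = id
  Sees-□ m (r ◅ rs) = Sees-□ m rs ∘ R₀-□ m r

  -- Under the box at `χ i`, every atom either asserts `X` or is excluded as not seen from `i`.
  □-witness : ∀ {i} → X ∈ˡ Ψ → (∀ j → R₀ i j → ¬ Neg j X) → Th (χ i ⇒ □ X)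
  □-witness {X} {i} m f = by-cases (under ded mod-□ (χ i)) λ j → go j (decides j m)
    where
    go : ∀ j → Pos j X ⊎ Neg j X → Th (χ i ⇒ □ (χ j ⇒ X))
    go j (inj₁ g) = weaken ded (χ i) (□.nec (pos g))
    go j (inj₂ g) with seen-□? i j
    ... | yes u = entail (under ded mod-□ (χ i)) (u ∷ []) λ { (u ∷ []) → ⇒I λ h → ⊥-elim (~E u h) }
    ... | no r  = ⊥-elim (f j r g)

  -- If `χ j` denies `X`, then `χ i` implies `[≠] ~ χ j`. For `j` equal to `i` this makes `i`
  -- irreflexive; otherwise `χ j`, which must hold somewhere, has no place left.
  R≠-[≠] : ∀ {i j} → Live i → R≠ i j → Pos i ([≠] X) → ¬ Neg j X
  R≠-[≠] {X} {i} l (inj₁ (refl , ref)) f g = ref l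
    (entail (under ded mod-≠ (χ i)) (pos f ∷ []) λ { (x ∷ []) → ~I λ h → ~E (g h) x })
  R≠-[≠] {X} {i} {j} l (inj₂ (i≢j , _ , lⱼ)) f g = l
    (entail ded (never-j ∷ somewhere lⱼ ∷ [])
      λ { (n ∷ s ∷ []) → ~I λ h → ~E s (∧I (⇒E n h) (distinct i≢j h)) })
    where
    never-j : Th (χ i ⇒ [≠] ~ χ j)
    never-j = entail (under ded mod-≠ (χ i)) (pos f ∷ []) λ { (x ∷ []) → ~I λ h → ~E (g h) x }

  ≠-witness : ∀ {i} → Live i → X ∈ˡ Ψ → (∀ j → R≠ i j → ¬ Neg j X) → Th (χ i ⇒ [≠] X)
  ≠-witness {X} {i} l m f = by-cases (under ded mod-≠ (χ i)) λ j → go j (decides j m)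
    where
    avoid : ∀ {j} → Th (χ i ⇒ [≠] ~ χ j) → Th (χ i ⇒ [≠] (χ j ⇒ X))
    avoid u = entail (under ded mod-≠ (χ i)) (u ∷ []) λ { (u ∷ []) → ⇒I λ h → ⊥-elim (~E u h) }
    go : ∀ j → Pos j X ⊎ Neg j X → Th (χ i ⇒ [≠] (χ j ⇒ X))
    go j (inj₁ g) = weaken ded (χ i) (≠.nec (pos g))
    go j (inj₂ g) with i ≟ j
    ... | yes refl with seen-≠? i
    ...   | yes u = avoid u
    ...   | no r  = ⊥-elim (f i (inj₁ (refl , λ _ → r)) g)
    go j (inj₂ g) | no i≢j with dead-or-Live j
    ...   | inj₁ dead = avoid (weaken ded (χ i) (≠.nec dead))
    ...   | inj₂ lⱼ   = ⊥-elim (f j (inj₂ (i≢j , l , lⱼ)) g)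

  R≠-target : ∀ {i j} → Live i → R≠ i j → Live j
  R≠-target l (inj₁ (refl , _))   = l
  R≠-target l (inj₂ (_ , _ , lⱼ)) = lⱼ

  R≠-sym : ∀ {i j} → R≠ i j → R≠ j i
  R≠-sym (inj₁ (refl , r))        = inj₁ (refl , r)
  R≠-sym (inj₂ (i≢j , lᵢ , lⱼ)) = inj₂ (i≢j ∘ sym , lⱼ , lᵢ)

  R≠-trans : ∀ {i j k} → R≠ i j → R≠ j k → i ≡ k ⊎ R≠ i k
  R≠-trans (inj₁ (refl , _)) s          = inj₂ s
  R≠-trans r@(inj₂ _) (inj₁ (refl , _)) = inj₂ r
  R≠-trans {i} {k = k} (inj₂ (_ , lᵢ , _)) (inj₂ (_ , _ , lₖ)) with i ≟ k
  ... | yes i≡k = inj₁ i≡k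
  ... | no i≢k  = inj₂ (inj₂ (i≢k , lᵢ , lₖ))

  Sees⊆R≠ : ∀ {i j} → Sees i j → i ≡ j ⊎ R≠ i j
  Sees⊆R≠ {i} {j} s with i ≟ j
  ... | yes i≡j = inj₁ i≡j
  ... | no i≢j  = let lᵢ = Sees-source i≢j s in inj₂ (inj₂ (i≢j , lᵢ , Sees-target lᵢ s))

  -- A reflexive atom is its own witness. A live irreflexive atom that saw only itself would satisfy
  -- both `[≠] ~ χ i` and `□ ~ ~ χ i`, which DS forbids.
  Sees-serial : (∀ {A} → Th ([≠] A ⇒ ◇ A)) → ∀ i → ∃[ j ] Sees i j × R≠ i j
  Sees-serial ax-DS i with dead-or-Live i | seen-≠? i
  ... | inj₁ dead | _      = i , ε , inj₁ (refl , λ l → contradiction dead l)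
  ... | inj₂ l    | no ref = i , ε , inj₁ (refl , λ _ → ref)
  ... | inj₂ l    | yes irr with any? (λ j → ¬? (i ≟ j) ×-dec ¬? (seen-□? i j))
  ...   | yes (j , i≢j , r) = j , r ◅ ε , inj₂ (i≢j , l , R₀-target r)
  ...   | no none = contradiction
    (entail ded (only-i ∷ irr ∷ ax-DS ∷ [])
      λ { (o ∷ r ∷ d ∷ []) → ~I λ h → ~E (⇒E d (⇒E r h)) (⇒E o h) })
    l
    where
    only-i : Th (χ i ⇒ □ ~ ~ χ i)
    only-i = by-cases (under ded mod-□ (χ i)) λ j → go j (i ≟ j) (seen-□? i j)
      where
      go : ∀ j → Dec (i ≡ j) → Dec (Th (χ i ⇒ □ ~ χ j)) → Th (χ i ⇒ □ (χ j ⇒ ~ ~ χ i))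
      go j (yes refl) _     = weaken ded (χ i) (□.nec (⊨⇒∈ (⇒I λ h → ~I λ k → ~E k h)))
      go j (no i≢j) (no r)  = contradiction (j , i≢j , r) none
      go j (no i≢j) (yes u) =
        entail (under ded mod-□ (χ i)) (u ∷ []) λ { (u ∷ []) → ⇒I λ h → ⊥-elim (~E u h) }

  -- An irreflexive atom is a singleton, and AT₁ makes singletons closed: wherever `χ j` holds only
  -- elsewhere, `□ ~ χ j` holds. This is the case at `χ i`.
  Irreflexive-unseen : (∀ {A} → Th ([≠] A ⇒ [≠] □ A)) → ∀ {i j} →
                       i ≢ j → R₀ i j → Live j → ¬ Irreflexive j
  Irreflexive-unseen ax-AT {i} {j} i≢j r l irr = r
    (entail ded (other ∷ somewhere l ∷ [])
      λ { (o ∷ s ∷ []) → ⇒I λ h → ⊨-stable λ ¬b →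
          ~E s (∧I (⊨-stable λ ¬n → ¬b (⇒E o (~I ¬n))) (distinct i≢j h)) })
    where
    -- B-D read backwards: ⟨≠⟩ [≠] B entails B.
    other : Th (~ ([≠] (~ χ j)) ⇒ □ ~ χ j)
    other = entail ded (back ∷ ax-B ∷ [])
      λ { (k ∷ b ∷ []) → ⇒I λ s → ⊨-stable λ ¬u → ~E s (⇒E k (⇒E b (~I ¬u))) }
      where
      back : Th ([≠] (⟨≠⟩ (~ (□ ~ χ j))) ⇒ [≠] (~ χ j))
      back = mono ded mod-≠ (entail ded (irr ∷ ax-AT ∷ ≠-dn ∷ [])
        λ { (i ∷ a ∷ d ∷ []) → ⇒I λ k → ~I λ h → ~E k (⇒E d (⇒E a (⇒E i h))) })
        where
        ≠-dn : Th ([≠] □ ~ χ j ⇒ [≠] (~ ~ (□ ~ χ j)))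
        ≠-dn = mono ded mod-≠ (⊨⇒∈ (⇒I λ u → ~I λ n → ~E n u))

  -- Only a return to `i` through a different atom is delicate: `i` is then seen from elsewhere, so
  -- it cannot be irreflexive.
  R≠-R₀ : (∀ {A} → Th ([≠] A ⇒ [≠] □ A)) → ∀ {i j k} → R≠ i j → R₀ j k → R≠ i k
  R≠-R₀ ax-AT {i} {j} {k} s r with i ≟ k
  ... | no i≢k  = inj₂ (i≢k , R≠-target (R₀-source r) (R≠-sym s) , R₀-target r)
  ... | yes refl with s
  ...   | inj₁ (refl , ref)     = inj₁ (refl , ref)
  ...   | inj₂ (i≢j , l , _) =
    inj₁ (refl , λ _ → Irreflexive-unseen ax-AT (i≢j ∘ sym) r l)

  R≠-Sees : (∀ {A} → Th ([≠] A ⇒ [≠] □ A)) → ∀ {i j k} → R≠ i j → Sees j k → R≠ i k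
  R≠-Sees ax-AT s ε        = s
  R≠-Sees ax-AT s (r ◅ rs) = R≠-Sees ax-AT (R≠-R₀ ax-AT s r) rs

  -- Relations are taken up to equivalence so that the results apply to frames given by tables.
  module _ (i₀ : Fin size) {R R-D : Rel (Fin size) 0ℓ}
           (R⇔ : ∀ i j → R i j ⇔ Sees i j) (R-D⇔ : ∀ i j → R-D i j ⇔ R≠ i j) where

    F : Frame
    F = record { W = Fin size ; point = i₀ ; R = R ; R-D = R-D }

    private
      module R   i j = Equivalence (R⇔ i j)
      module R-D i j = Equivalence (R-D⇔ i j)

    -- The truth lemma of the filtration, by simultaneous induction for asserted and denied
    -- formulas. It is confined to live atoms, whose successors are live again.
    truth⁺ : ∀ B → (∀ {C} → C ∈ˡ subformulas B → C ∈ˡ Ψ) → ∀ i → Live i →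
             Pos i B → truth F letters i B
    truth⁻ : ∀ B → (∀ {C} → C ∈ˡ subformulas B → C ∈ˡ Ψ) → ∀ i → Live i →
             Neg i B → ¬ truth F letters i B

    truth⁺ (var n) inc i l f = decidable-stable (T? _)
      λ ¬t → pos-neg l f (¬letter⇒Neg (inc (here refl)) i ¬t)
    truth⁺ bot     inc i l f = l (⊨⇒∈ (~I λ h → ⊭bot (f h)))
    truth⁺ (A ⇒ B) inc i l f a with decides i (inc (there (∈-++⁺ˡ (self∈subformulas A))))
    ... | inj₂ a⁻ = ⊥-elim (truth⁻ A (inc ∘ there ∘ ∈-++⁺ˡ) i l a⁻ a)
    ... | inj₁ a⁺ = truth⁺ B (inc ∘ there ∘ ∈-++⁺ʳ (subformulas A)) i l λ h → ⇒E (f h) (a⁺ h)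
    truth⁺ (□ B) inc i l f j r with decides j (inc (there (self∈subformulas B)))
    ... | inj₁ b⁺ = truth⁺ B (inc ∘ there) j (Sees-target l (R.to i j r)) b⁺
    ... | inj₂ b⁻ = ⊥-elim (clash (Sees-target l (R.to i j r)) b⁻
      -- The formula `□ B` travels along the path to `j`, where T-□ turns it into `B`.
      (entail ded (ax-T ∷ []) λ { (t ∷ []) → ⇒I λ h →
        ⇒E t (Sees-□ (inc (here refl)) (R.to i j r) f h) }))
    truth⁺ ([≠] B) inc i l f j r with decides j (inc (there (self∈subformulas B)))
    ... | inj₁ b⁺ = truth⁺ B (inc ∘ there) j (R≠-target l (R-D.to i j r)) b⁺
    ... | inj₂ b⁻ = ⊥-elim (R≠-[≠] l (R-D.to i j r) f b⁻)

    truth⁻ (var n) inc i l f t = pos-neg l (letter⇒Pos (inc (here refl)) i t) f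
    truth⁻ bot     inc i l f t = t
    truth⁻ (A ⇒ B) inc i l f t =
      truth⁻ B (inc ∘ there ∘ ∈-++⁺ʳ (subformulas A)) i l
        (λ h → ~I λ b → ~E (f h) (⇒I λ _ → b))
        (t (truth⁺ A (inc ∘ there ∘ ∈-++⁺ˡ) i l
          λ h → ⊨-stable λ ¬a → ~E (f h) (⇒I (⊥-elim ∘ ¬a))))
    truth⁻ (□ B) inc i l f t = clash l f
      (□-witness (inc (there (self∈subformulas B))) λ j r b⁻ →
        truth⁻ B (inc ∘ there) j (R₀-target r) b⁻ (t j (R.from i j (r ◅ ε))))
    truth⁻ ([≠] B) inc i l f t = clash l f
      (≠-witness l (inc (there (self∈subformulas B))) λ j r b⁻ →
        truth⁻ B (inc ∘ there) j (R≠-target l r) b⁻ (t j (R-D.from i j r)))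

    isS4DFrame : S4DFrame F
    isS4DFrame =
        (λ x y → R-D.from y x ∘ R≠-sym ∘ R-D.to x y)
      , (λ x y z xy yz → Sum.map₂ (R-D.from x z) (R≠-trans (R-D.to x y xy) (R-D.to y z yz)))
      , (λ x y → Sum.map₂ (R-D.from x y) ∘ Sees⊆R≠ ∘ R.to x y)
      , (λ x → R.from x x ε)
      , (λ x y z xy yz → R.from x z (R.to x y xy ◅◅ R.to y z yz))

    isSerial : (∀ {A} → Th ([≠] A ⇒ ◇ A)) → Serial F
    isSerial ax-DS x =
      let (y , xy , xy≠) = Sees-serial ax-DS x in y , R.from x y xy , R-D.from x y xy≠

    isT₁ : (∀ {A} → Th ([≠] A ⇒ [≠] □ A)) → T₁ F
    isT₁ ax-AT x y z xy yz = R-D.from x z (R≠-Sees ax-AT (R-D.to x y xy) (R.to y z yz))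

-- Frames as finite tables and decidable frame conditions.

-- Relations are coded as subsets of a finite set of pairs, so that all of them can be searched.
tableFrame : ∀ {n} → Fin n → Subset (n *ℕ n) → Subset (n *ℕ n) → Frame
tableFrame {n} i r d = record
  { W = Fin n ; point = i ; R = λ x y → combine x y ∈ˢ r ; R-D = λ x y → combine x y ∈ˢ d }

tableFrame-finite : ∀ {n} (i : Fin n) r d → Finite (tableFrame i r d)
tableFrame-finite {n} i r d = record
  { size = n ; enum = ↔-id _
  ; R? = λ x y → combine x y ∈? r ; R-D? = λ x y → combine x y ∈? d }

tabulated : ∀ {n} {Q : Rel (Fin n) 0ℓ} → (∀ i j → Dec (Q i j)) →
            ∃[ s ] (∀ i j → combine i j ∈ˢ s ⇔ Q i j)
tabulated {n} {Q} Q? = s , λ i j → mk⇔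
  (λ m → decided (Q? i j) (trans (sym (entry i j)) ([]=⇒lookup m)))
  (λ q → lookup⇒[]= (combine i j) s (trans (entry i j) (dec-true (Q? i j) q)))
  where
  s : Subset (n *ℕ n)
  s = tabulate λ x → let (i , j) = remQuot n x in does (Q? i j)
  entry : ∀ i j → lookup s (combine i j) ≡ does (Q? i j)
  entry i j = trans (lookup∘tabulate _ (combine i j))
                    (cong (λ (i , j) → does (Q? i j)) (remQuot-combine i j))
  decided : ∀ {P : Set} (P? : Dec P) → does P? ≡ true → P
  decided (yes p) _ = p

-- Double negation passes through finite quantifiers, so finitely many undecided questions may be
-- taken as settled when the goal is absurdity.
¬¬-∀ : ∀ {n} {P : Fin n → Set} → (∀ i → ¬ ¬ P i) → ¬ ¬ (∀ i → P i)
¬¬-∀ = sequence (RawMonad.rawApplicative ¬¬-Monad)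

¬¬-decidable : ∀ {n} (Q : Rel (Fin n) 0ℓ) → ¬ ¬ (∀ i j → Dec (Q i j))
¬¬-decidable Q = ¬¬-∀ λ i → ¬¬-∀ λ j → ¬¬-excluded-middle

S4DFrame? : ∀ {F} → Finite F → Dec (S4DFrame F)
S4DFrame? {F} fin =
        all-W? (λ x → all-W? λ y → R-D? x y →-dec R-D? y x)
  ×-dec all-W? (λ x → all-W? λ y → all-W? λ z →
          R-D? x y →-dec R-D? y z →-dec (x ≟W z ⊎-dec R-D? x z))
  ×-dec all-W? (λ x → all-W? λ y → R? x y →-dec (x ≟W y ⊎-dec R-D? x y))
  ×-dec all-W? (λ x → R? x x)
  ×-dec all-W? (λ x → all-W? λ y → all-W? λ z → R? x y →-dec R? y z →-dec R? x z)
  where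
  open Finite fin
  open FiniteFrame fin
  open Inverse enum using (to; from; strictlyInverseʳ)
  _≟W_ : ∀ x y → Dec (x ≡ y)
  x ≟W y = map′ (λ e → trans (sym (strictlyInverseʳ x)) (trans (cong from e) (strictlyInverseʳ y)))
                (cong to) (to x ≟ to y)

Serial? : ∀ {F} → Finite F → Dec (Serial F)
Serial? fin = all-W? λ x → any-W? λ y → R? x y ×-dec R-D? x y
  where
  open Finite fin
  open FiniteFrame fin

T₁? : ∀ {F} → Finite F → Dec (T₁ F)
T₁? fin = all-W? λ x → all-W? λ y → all-W? λ z → R-D? x y →-dec R? y z →-dec R-D? x z
  where
  open Finite fin
  open FiniteFrame fin

-- The finite model property, uniformly in the logic.

-- `Cond` is the frame condition beyond `S4DFrame`. The hypothesis `canonical` says that it follows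
-- from what DS and AT₁ yield when they belong to `L`, so one argument serves all three logics.
module _
  {L : Pred Formula 0ℓ} (isLogic : IsLogic L) (S4D⊆L : S4D ⊆ L)
  (Cond : Frame → Set) (Cond? : ∀ {F} → Finite F → Dec (Cond F))
  (sound : ∀ {F} → Finite F → S4DFrame F → Cond F → L ⊆ Valid F)
  (canonical : ∀ {F} → (DS ∈ L → Serial F) → (AT₁ ∈ L → T₁ F) → Cond F)
  where

  private
    S = isLogic⇒S4DTheory isLogic S4D⊆L
    open S4DTheory S using (ded)

  fmp : HasFMP L
  fmp A A∉L with any? (λ i → anySubset? λ r → anySubset? λ d → good? i r d)
    where
    open Partition (partition (subformulas A))
    open Atoms (partition (subformulas A))
    good? : ∀ i r d → Dec (S4DFrame (tableFrame i r d) × Cond (tableFrame i r d) ×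
                           ¬ truth (tableFrame i r d) letters i A)
    good? i r d = S4DFrame? fin ×-dec Cond? fin ×-dec ¬? (FiniteFrame.truth? fin letters i A)
      where fin = tableFrame-finite i r d
  ... | yes (i , r , d , s4d , cond , false-at-i) =
    let fin = tableFrame-finite i r d in
    tableFrame i r d , fin , (λ B → sound fin s4d cond) , λ valid → false-at-i (valid _ i)
  ... | no none = ⊥-elim
    -- The extension starts from the truth constant `~ bot`, which does not imply `A` since `A` is
    -- not in `L`.
    (decide-all ded (List.tabulate λ i → [∀] (~ χ i)) (~ bot)
      (λ h → A∉L (Deductive.detach ded h (Deductive.⊨⇒∈ ded (~I ⊭bot))))
    λ (C , _ , C⊬A , decided) →
    ¬¬-decidable (λ i j → Global S C (χ i ⇒ □ ~ χ j)) λ seen-□? →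
    ¬¬-∀ (λ i → ¬¬-excluded-middle {A = Global S C (χ i ⇒ [≠] ~ χ i)}) λ seen-≠? →
    build C C⊬A decided seen-□? seen-≠?)
    where
    P = partition (subformulas A)
    open Partition P
    open Atoms P
    build : ∀ C → ¬ L (C ⇒ A) →
            All (λ U → L (C ⇒ U) ⊎ L (C ⇒ ~ U)) (List.tabulate λ i → [∀] (~ χ i)) →
            (∀ i j → Dec (Global S C (χ i ⇒ □ ~ χ j))) →
            (∀ i → Dec (Global S C (χ i ⇒ [≠] ~ χ i))) → ⊥
    build C C⊬A decided seen-□? seen-≠? =
      ¬¬-decidable Sees λ Sees? → ¬¬-decidable R≠ λ R≠? →
      let (r , r⇔) = tabulated Sees?
          (d , d⇔) = tabulated R≠?
          refutes : ∀ i → Live i → Neg i A → ⊥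
          refutes i l neg = none (i , r , d , isS4DFrame i r⇔ d⇔
            , canonical (λ ds → isSerial i r⇔ d⇔ λ {B} → (Global-⊇ S C (I.sub (λ _ → B) ds)))
                        (λ at → isT₁ i r⇔ d⇔ λ {B} → (Global-⊇ S C (I.sub (λ _ → B) at)))
            , truth⁻ i r⇔ d⇔ A id i l neg)
      -- A failed search means that no live atom denies `A`. Every atom then implies `A` in the
      -- theory, hence `C` implies `A` in `L`.
      in C⊬A (Global-⊆ S C (by-cases (S4DTheory.ded Th) λ i →
           everywhere refutes i (dead-or-Live i) (decides i (self∈subformulas A))))
      where
      module I = IsLogic isLogic
      Th = Global-S4D S C
      consistent : ¬ Global S C bot
      consistent h = C⊬A (entail ded (Global-⊆ S C h ∷ [])
        λ { (h ∷ []) → ⇒I λ c → ⊥-elim (⊭bot (⇒E h c)) })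
      live : ∀ i → Global S C (~ χ i) ⊎ Global S C (~ ([∀] (~ χ i)))
      live i = Sum.map (Global-[∀] S C) (Global-~[∀]~ S C) (AllP.tabulate⁻ decided i)
      open Canonical Th consistent P live seen-□? seen-≠?
      everywhere : (∀ i → Live i → Neg i A → ⊥) → ∀ i → Global S C (~ χ i) ⊎ Live i →
                   Pos i A ⊎ Neg i A → Global S C (χ i ⇒ A)
      everywhere refutes i _           (inj₁ f) = pos f
      everywhere refutes i (inj₂ l)    (inj₂ g) = ⊥-elim (refutes i l g)
      everywhere refutes i (inj₁ dead) (inj₂ g) =
        entail (S4DTheory.ded Th) (dead ∷ []) λ { (d ∷ []) → ⇒I λ h → ⊥-elim (~E d h) }

theorem5p4 : HasFMP S4D × HasFMP S4DS × HasFMP S4DT₁S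
theorem5p4 =
    fmp (Generated-isLogic _) id
      (λ _ → ⊤) (λ _ → yes tt)
      (λ fin s4d _ → Sound.S4D-valid fin s4d)
      (λ _ _ → tt)
  , fmp (Generated-isLogic _) (axiom ∘ inj₁)
      Serial Serial?
      (λ fin s4d serial → Sound.S4DS-valid fin s4d serial)
      (λ serial _ → serial (axiom (inj₂ (here refl))))
  , fmp (Generated-isLogic _) (axiom ∘ inj₁ ∘ axiom ∘ inj₁)
      (λ F → Serial F × T₁ F) (λ fin → Serial? fin ×-dec T₁? fin)
      (λ fin s4d (serial , t₁) → Sound.S4DT₁S-valid fin s4d serial t₁)
      (λ serial t₁ → serial (axiom (inj₁ (axiom (inj₂ (here refl))))) , t₁ (axiom (inj₂ (here refl))))
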